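{- There is an absolute constant $C>0$ such that the following holds for all positive integers $M_1,N_1,M_2,N_2$. Let $S$ be the set of pairs $(A,B)\in\mathbb{Z}^2$ such that $M_1\le |A|\le M_1+N_1$, $M_2\le |B|\le M_2+N_2$, the equation $y^2=x^3+Ax+B$ defines an elliptic curve $E$ over $\mathbb{Q}$, and $E[3](\mathbb{Q})\ne\{0_E\}$. Then \[ \# S\le C\,\frac{N_1N_2}{\sqrt{\min\{N_1,N_2\}}}. \]
   Context: $E[3](\mathbb{Q})$ denotes the group of $\mathbb{Q}$-rational points of $E$ killed by $3$, and $0_E$ is the identity element. -}

module Defs where

open import Data.Integer.Base as ℤ using (ℤ; ∣_∣; 0ℤ)
open import Data.List.Base using (List; length)
open import Data.List.Relation.Unary.All using (All)
open import Data.List.Relation.Unary.Unique.Propositional using (Unique)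
open import Data.Nat.Base as ℕ using (ℕ; zero; suc)
open import Data.Product.Base using (_×_; proj₁; proj₂)
open import Data.Rational.Base as ℚ
  using (ℚ; 0ℚ; _+_; _*_; _-_; _÷_; ≢-nonZero)
open import Data.Rational.Properties using (_≟_)
open import Level using (0ℓ)
open import Relation.Binary.PropositionalEquality using (_≡_; _≢_)
open import Relation.Nullary using (¬_; yes; no)
open import Relation.Unary using (Pred; ｛_｝; _≐_)

fromℤ : ℤ → ℚ
fromℤ n = n ℚ./ 1

-- y² = x³ + Ax + B defines an elliptic curve iff its discriminant
-- −16(4A³ + 27B²) is nonzero.
IsElliptic : ℤ → ℤ → Set
IsElliptic A B =
  ℤ.- (ℤ.+ 16) ℤ.* (ℤ.+ 4 ℤ.* A ℤ.^ 3 ℤ.+ ℤ.+ 27 ℤ.* B ℤ.^ 2) ≢ 0ℤ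

-- Points of the projective closure; 0E is the point at infinity [0 : 1 : 0].
data Point : Set where
  0E     : Point
  affine : (x y : ℚ) → Point

module Curve (a b : ℚ) where

  data OnCurve : Pred Point 0ℓ where
    0E     : OnCurve 0E
    affine : ∀ {x y} → y * y ≡ x * x * x + a * x + b → OnCurve (affine x y)

  -- The third intersection of the curve with the line of slope m through
  -- its points (x₁ , y₁) and (x₂ , _), reflected in the x-axis.
  reflectThird : (m x₁ y₁ x₂ : ℚ) → Point
  reflectThird m x₁ y₁ x₂ = affine x₃ (m * (x₁ - x₃) - y₁)
    where
    x₃ : ℚ
    x₃ = m * m - x₁ - x₂

  -- The chord–tangent group law. It is defined for arbitrary pairs of rational
  -- coordinates but is only meaningful on points satisfying OnCurve: there,
  -- x₁ ≡ x₂ and y₁ + y₂ ≢ 0 force y₁ ≡ y₂, so the last case is a doubling,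
  -- whose tangent slope (3x₁² + a) / 2y₁ has denominator y₁ + y₂.
  infixl 6 _⊕_
  _⊕_ : Point → Point → Point
  0E           ⊕ Q            = Q
  P@(affine _ _) ⊕ 0E         = P
  affine x₁ y₁ ⊕ affine x₂ y₂ with x₂ - x₁ ≟ 0ℚ | y₁ + y₂ ≟ 0ℚ
  ... | no  x₂-x₁≢0 | _            =
    reflectThird (((y₂ - y₁) ÷ (x₂ - x₁)) {{≢-nonZero x₂-x₁≢0}}) x₁ y₁ x₂
  ... | yes _       | yes _        = 0E
  ... | yes _       | no  y₁+y₂≢0 =
    reflectThird (((fromℤ (ℤ.+ 3) * (x₁ * x₁) + a) ÷ (y₁ + y₂)) {{≢-nonZero y₁+y₂≢0}})
                 x₁ y₁ x₂

  infixr 7 _·_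
  _·_ : ℕ → Point → Point
  zero  · P = 0E
  suc n · P = P ⊕ n · P

  -- E[n](ℚ)
  Torsion : ℕ → Pred Point 0ℓ
  Torsion n P = OnCurve P × n · P ≡ 0E

E[_]⟨_,_⟩ : ℕ → ℤ → ℤ → Pred Point 0ℓ
E[ n ]⟨ A , B ⟩ = Curve.Torsion (fromℤ A) (fromℤ B) n

record S (M₁ N₁ M₂ N₂ : ℕ) (AB : ℤ × ℤ) : Set where
  constructor mkS
  A = proj₁ AB
  B = proj₂ AB
  field
    A-lower    : M₁ ℕ.≤ ∣ A ∣
    A-upper    : ∣ A ∣ ℕ.≤ M₁ ℕ.+ N₁
    B-lower    : M₂ ℕ.≤ ∣ B ∣
    B-upper    : ∣ B ∣ ℕ.≤ M₂ ℕ.+ N₂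
    elliptic   : IsElliptic A B
    3-torsion  : ¬ (E[ 3 ]⟨ A , B ⟩ ≐ ｛ 0E ｝)

-- # P ≤ c / √d, for a predicate P read as a set and d > 0, with the real
-- inequality squared and cleared of its denominator. A bound on # P is a bound
-- on the length of every duplicate-free list of elements of P.
#_≤_/√_ : {X : Set} → Pred X 0ℓ → ℕ → ℕ → Set
#_≤_/√_ {X} P c d =
  (xs : List X) → Unique xs → All P xs → length xs ℕ.^ 2 ℕ.* d ℕ.≤ c ℕ.^ 2

{-# OPTIONS --safe #-}
-- A rational point (x , y) of order 3 is a flex. If m is the slope of its tangent,
-- then t = m² = 3x is a nonzero root of the monic quartic
-- t⁴ + 18At² + 108Bt − 27A², hence a positive integer. Two such roots u and
-- v = u + d belonging to the same A satisfy
--   108 (B − B′) uv = d³ uv + 3d (3A + uv)²,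
-- so d³ ≤ 108 N₂ as soon as B and B′ have the same sign. Hence, for k² > 108 N₂,
-- a pair (A , B) in S is determined by A, the sign of B and the residue of its
-- root mod k, and # S ≤ 4 (N₁ + 1) k = O (N₁ √N₂) ≤ O (N₁ N₂ / √min (N₁ , N₂)).
module Submission where

open import Data.Fin.Base using (Fin; zero; suc; fromℕ<; combine)
open import Data.Fin.Properties using (injective⇒≤; combine-injective; fromℕ<-injective)
open import Data.Integer.Base as ℤ using (ℤ; +_; -[1+_]; ∣_∣; 0ℤ; sign)
import Data.Integer.Divisibility.Signed as ℤ
import Data.Integer.Properties as ℤ
open import Data.Integer.Solver using () renaming (module +-*-Solver to ℤ-Solver)
open import Data.List.Base using (List; _∷_; length; lookup)
open import Data.List.Membership.Propositional.Properties using (∈-lookup)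
open import Data.List.Relation.Unary.All as All using (All)
open import Data.List.Relation.Unary.Unique.Propositional using (Unique; _∷_)
open import Data.Nat.Base using (ℕ; zero; suc; NonZero; _+_; _*_; _∸_; _^_; _⊓_; _≤_; _<_; z≤n; s≤s;
  >-nonZero; ≢-nonZero; ≢-nonZero⁻¹)
open import Data.Nat.Coprimality as Coprimality using (Coprime; coprime-divisor)
open import Data.Nat.Divisibility using (_∣_; divides; ∣-refl; ∣⇒≤; 0∣⇒≡0)
open import Data.Nat.DivMod using (_/_; _%_; m≡m%n+[m/n]*n; m%n<n)
open import Data.Nat.Properties
open import Data.Nat.Tactic.RingSolver using (solve-∀)
open import Data.Product.Base using (∃-syntax; _×_; _,_; proj₁; proj₂)
open import Data.Rational.Base as ℚ using (ℚ; mkℚ; 0ℚ; toℚᵘ; ↥_; ↧_)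
import Data.Rational.Properties as ℚ
open import Data.Rational.Solver using () renaming (module +-*-Solver to ℚ-Solver)
open import Data.Rational.Unnormalised.Base as ℚᵘ using (mkℚᵘ; *≡*)
import Data.Rational.Unnormalised.Properties as ℚᵘ
open import Data.Sign.Base as Sign using (Sign)
open import Data.Sum.Base using (inj₁; inj₂)
open import Level using (0ℓ)
open import Relation.Binary.PropositionalEquality
open import Relation.Nullary using (¬_; yes; no; contradiction)
open import Relation.Unary using (Pred; _≐_; ｛_｝)
open import Defs

-- The 3-division polynomial 3x⁴ + 6Ax² + 12Bx - A², made monic by multiplying with 27 and
-- substituting t = 3x.
quartic : ℤ → ℤ → ℤ → ℤ
quartic A B t =
  t ℤ.* t ℤ.* t ℤ.* t ℤ.+ + 18 ℤ.* A ℤ.* (t ℤ.* t) ℤ.+ + 108 ℤ.* B ℤ.* t ℤ.- + 27 ℤ.* (A ℤ.* A)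

quarticℚ : ℚ → ℚ → ℚ → ℚ
quarticℚ a b t =
  t ℚ.* t ℚ.* t ℚ.* t ℚ.+ fromℤ (+ 18) ℚ.* a ℚ.* (t ℚ.* t) ℚ.+ fromℤ (+ 108) ℚ.* b ℚ.* t
    ℚ.- fromℤ (+ 27) ℚ.* (a ℚ.* a)

module _ where
  open ℤ-Solver

  :quartic : ∀ {n} (A B t : Polynomial n) → Polynomial n
  :quartic A B t =
    t :* t :* t :* t :+ con (+ 18) :* A :* (t :* t) :+ con (+ 108) :* B :* t :- con (+ 27) :* (A :* A)

module _ where
  open ℚ-Solver

  :fromℕ : ∀ {n} → ℕ → Polynomial n
  :fromℕ i = con (fromℤ (+ i))

  :quarticℚ : ∀ {n} (a b t : Polynomial n) → Polynomial n
  :quarticℚ a b t =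
    t :* t :* t :* t :+ :fromℕ 18 :* a :* (t :* t) :+ :fromℕ 108 :* b :* t :- :fromℕ 27 :* (a :* a)

-- The root given by a point of order 3

module _ (a b : ℚ) where
  open Curve a b

  -- Of the three affine clauses of `_⊕_`, only the one for a vertical chord returns `0E`.
  ⊕≡0E⇒x-equal : ∀ {x₁ y₁ x₂ y₂} → affine x₁ y₁ ⊕ affine x₂ y₂ ≡ 0E → x₂ ℚ.- x₁ ≡ 0ℚ
  ⊕≡0E⇒x-equal {x₁} {y₁} {x₂} {y₂} eq with x₂ ℚ.- x₁ ℚ.≟ 0ℚ | y₁ ℚ.+ y₂ ℚ.≟ 0ℚ
  ⊕≡0E⇒x-equal () | no _    | _
  ⊕≡0E⇒x-equal _  | yes x≡0 | yes _ = x≡0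
  ⊕≡0E⇒x-equal () | yes _   | no _

  -- `3 · P` unfolds to P ⊕ 2P. If y + y vanishes then 2P is `0E` and the sum is P, which is affine;
  -- otherwise 2P has x-coordinate m² - 2x, which must agree with x.
  3-torsion⇒slope : ∀ x y → 3 · affine x y ≡ 0E → ∃[ m ]
    (m ℚ.* (y ℚ.+ y) ≡ fromℤ (+ 3) ℚ.* (x ℚ.* x) ℚ.+ a × m ℚ.* m ℚ.- x ℚ.- x ℚ.- x ≡ 0ℚ)
  3-torsion⇒slope x y 3P≡0E with x ℚ.- x ℚ.≟ 0ℚ | y ℚ.+ y ℚ.≟ 0ℚ
  3-torsion⇒slope x y _  | no x-x≢0 | _     = contradiction (ℚ.+-inverseʳ x) x-x≢0
  3-torsion⇒slope x y () | yes _    | yes _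
  3-torsion⇒slope x y 3P≡0E | yes _ | no y+y≢0 =
    m , slope , ⊕≡0E⇒x-equal {y₂ = m ℚ.* (x ℚ.- (m ℚ.* m ℚ.- x ℚ.- x)) ℚ.- y} 3P≡0E
    where
    instance
      y+y-nonZero : ℚ.NonZero (y ℚ.+ y)
      y+y-nonZero = ℚ.≢-nonZero y+y≢0

    n m : ℚ
    n = fromℤ (+ 3) ℚ.* (x ℚ.* x) ℚ.+ a
    m = n ℚ.÷ (y ℚ.+ y)

    slope : m ℚ.* (y ℚ.+ y) ≡ n
    slope = trans (ℚ.*-assoc n (ℚ.1/ (y ℚ.+ y)) (y ℚ.+ y))
      (trans (cong (n ℚ.*_) (ℚ.*-inverseˡ (y ℚ.+ y))) (ℚ.*-identityʳ n))

  -- With f = x³ + ax + b, the quartic at 3x is 27(12x f - f′²). On the curve f = y² and f′ = 2my,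
  -- so this becomes 108y²(3x - m²), which is zero at a flex.
  slope²-root : ∀ x y m → y ℚ.* y ≡ x ℚ.* x ℚ.* x ℚ.+ a ℚ.* x ℚ.+ b →
    m ℚ.* (y ℚ.+ y) ≡ fromℤ (+ 3) ℚ.* (x ℚ.* x) ℚ.+ a → m ℚ.* m ℚ.- x ℚ.- x ℚ.- x ≡ 0ℚ →
    quarticℚ a b (m ℚ.* m) ≡ 0ℚ
  slope²-root x y m curve slope flex = begin
    quarticℚ a b (m ℚ.* m)
      ≡⟨ cong (quarticℚ a b) m²≡3x ⟩
    quarticℚ a b (c 3 ℚ.* x)
      ≡⟨ expand a b x ⟩
    c 27 ℚ.* (c 12 ℚ.* x ℚ.* (x ℚ.* x ℚ.* x ℚ.+ a ℚ.* x ℚ.+ b) ℚ.- n ℚ.* n)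
      ≡⟨ cong₂ (λ r s → c 27 ℚ.* (c 12 ℚ.* x ℚ.* r ℚ.- s ℚ.* s)) curve slope ⟨
    c 27 ℚ.* (c 12 ℚ.* x ℚ.* (y ℚ.* y) ℚ.- m ℚ.* (y ℚ.+ y) ℚ.* (m ℚ.* (y ℚ.+ y)))
      ≡⟨ factor x y m ⟩
    c 108 ℚ.* (y ℚ.* y) ℚ.* ℚ.- (m ℚ.* m ℚ.- x ℚ.- x ℚ.- x)
      ≡⟨ cong (λ r → c 108 ℚ.* (y ℚ.* y) ℚ.* ℚ.- r) flex ⟩
    c 108 ℚ.* (y ℚ.* y) ℚ.* 0ℚ
      ≡⟨ ℚ.*-zeroʳ (c 108 ℚ.* (y ℚ.* y)) ⟩
    0ℚ ∎
    where
    open ≡-Reasoning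
    open ℚ-Solver

    c : ℕ → ℚ
    c i = fromℤ (+ i)

    n : ℚ
    n = c 3 ℚ.* (x ℚ.* x) ℚ.+ a

    m²≡3x : m ℚ.* m ≡ c 3 ℚ.* x
    m²≡3x = trans
      (solve 2 (λ x m → m :* m := (m :* m :- x :- x :- x) :+ :fromℕ 3 :* x) refl x m)
      (trans (cong (ℚ._+ c 3 ℚ.* x) flex) (ℚ.+-identityˡ (c 3 ℚ.* x)))

    expand : ∀ a b x → quarticℚ a b (c 3 ℚ.* x) ≡
      c 27 ℚ.* (c 12 ℚ.* x ℚ.* (x ℚ.* x ℚ.* x ℚ.+ a ℚ.* x ℚ.+ b)
        ℚ.- (c 3 ℚ.* (x ℚ.* x) ℚ.+ a) ℚ.* (c 3 ℚ.* (x ℚ.* x) ℚ.+ a))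
    expand = solve 3 (λ a b x → :quarticℚ a b (:fromℕ 3 :* x) :=
      :fromℕ 27 :* (:fromℕ 12 :* x :* (x :* x :* x :+ a :* x :+ b)
        :- (:fromℕ 3 :* (x :* x) :+ a) :* (:fromℕ 3 :* (x :* x) :+ a))) refl

    factor : ∀ x y m →
      c 27 ℚ.* (c 12 ℚ.* x ℚ.* (y ℚ.* y) ℚ.- m ℚ.* (y ℚ.+ y) ℚ.* (m ℚ.* (y ℚ.+ y))) ≡
      c 108 ℚ.* (y ℚ.* y) ℚ.* ℚ.- (m ℚ.* m ℚ.- x ℚ.- x ℚ.- x)
    factor = solve 3 (λ x y m →
      :fromℕ 27 :* (:fromℕ 12 :* x :* (y :* y) :- m :* (y :+ y) :* (m :* (y :+ y))) :=
      :fromℕ 108 :* (y :* y) :* (:- (m :* m :- x :- x :- x))) refl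

-- Integrality of the root

-- `fromℤ` normalises by a gcd and does not compute on variables; unnormalised fractions have the
-- literal denominator 1.
toℚᵘ-fromℤ : ∀ i → toℚᵘ (fromℤ i) ℚᵘ.≃ mkℚᵘ i 0
toℚᵘ-fromℤ i = ℚ.toℚᵘ-fromℚᵘ (mkℚᵘ i 0)

fromℤ-injective : ∀ {i j} → fromℤ i ≡ fromℤ j → i ≡ j
fromℤ-injective {i} {j} eq
  with *≡* i*1≡j*1 ← ℚᵘ.≃-trans (ℚᵘ.≃-sym (toℚᵘ-fromℤ i)) (ℚᵘ.≃-trans (ℚ.toℚᵘ-cong eq) (toℚᵘ-fromℤ j))
  = trans (sym (ℤ.*-identityʳ i)) (trans i*1≡j*1 (ℤ.*-identityʳ j))

fromℤ-homo-+ : ∀ i j → fromℤ (i ℤ.+ j) ≡ fromℤ i ℚ.+ fromℤ j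
fromℤ-homo-+ i j = ℚ.toℚᵘ-injective (begin
  toℚᵘ (fromℤ (i ℤ.+ j))              ≈⟨ toℚᵘ-fromℤ (i ℤ.+ j) ⟩
  mkℚᵘ (i ℤ.+ j) 0
    ≈⟨ *≡* (cong (ℤ._* + 1) (cong₂ ℤ._+_ (ℤ.*-identityʳ i) (ℤ.*-identityʳ j))) ⟨
  mkℚᵘ i 0 ℚᵘ.+ mkℚᵘ j 0              ≈⟨ ℚᵘ.+-cong (toℚᵘ-fromℤ i) (toℚᵘ-fromℤ j) ⟨
  toℚᵘ (fromℤ i) ℚᵘ.+ toℚᵘ (fromℤ j)  ≈⟨ ℚ.toℚᵘ-homo-+ (fromℤ i) (fromℤ j) ⟨
  toℚᵘ (fromℤ i ℚ.+ fromℤ j)          ∎)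
  where open ℚᵘ.≃-Reasoning

fromℤ-homo-* : ∀ i j → fromℤ (i ℤ.* j) ≡ fromℤ i ℚ.* fromℤ j
fromℤ-homo-* i j = ℚ.toℚᵘ-injective (begin
  toℚᵘ (fromℤ (i ℤ.* j))              ≈⟨ toℚᵘ-fromℤ (i ℤ.* j) ⟩
  mkℚᵘ i 0 ℚᵘ.* mkℚᵘ j 0              ≈⟨ ℚᵘ.*-cong (toℚᵘ-fromℤ i) (toℚᵘ-fromℤ j) ⟨
  toℚᵘ (fromℤ i) ℚᵘ.* toℚᵘ (fromℤ j)  ≈⟨ ℚ.toℚᵘ-homo-* (fromℤ i) (fromℤ j) ⟨
  toℚᵘ (fromℤ i ℚ.* fromℤ j)          ∎)
  where open ℚᵘ.≃-Reasoning

fromℤ-homo‿- : ∀ i → fromℤ (ℤ.- i) ≡ ℚ.- fromℤ i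
fromℤ-homo‿- i = ℚ.toℚᵘ-injective (begin
  toℚᵘ (fromℤ (ℤ.- i))  ≈⟨ toℚᵘ-fromℤ (ℤ.- i) ⟩
  ℚᵘ.- mkℚᵘ i 0         ≈⟨ ℚᵘ.-‿cong (toℚᵘ-fromℤ i) ⟨
  ℚᵘ.- toℚᵘ (fromℤ i)   ≈⟨ ℚ.toℚᵘ-homo‿- (fromℤ i) ⟨
  toℚᵘ (ℚ.- fromℤ i)    ∎)
  where open ℚᵘ.≃-Reasoning

*-denominator : ∀ t → t ℚ.* fromℤ (↧ t) ≡ fromℤ (↥ t)
*-denominator t@(mkℚ p d _) = ℚ.toℚᵘ-injective (begin
  toℚᵘ (t ℚ.* fromℤ (+ suc d))          ≈⟨ ℚ.toℚᵘ-homo-* t (fromℤ (+ suc d)) ⟩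
  mkℚᵘ p d ℚᵘ.* toℚᵘ (fromℤ (+ suc d))  ≈⟨ ℚᵘ.*-cong (ℚᵘ.≃-refl {mkℚᵘ p d}) (toℚᵘ-fromℤ (+ suc d)) ⟩
  mkℚᵘ p d ℚᵘ.* mkℚᵘ (+ suc d) 0
    ≈⟨ *≡* (trans (ℤ.*-identityʳ (p ℤ.* + suc d)) (cong (λ r → p ℤ.* + r) (sym (*-identityʳ (suc d))))) ⟩
  mkℚᵘ p 0                              ≈⟨ toℚᵘ-fromℤ p ⟨
  toℚᵘ (fromℤ p)                        ∎)
  where open ℚᵘ.≃-Reasoning

-- Embedding integer polynomial expressions into ℚ

infix 4 _↦_
infixl 6 _✚_
infixl 7 _✶_

-- A record rather than a bare equation, so that i and x can be inferred.
record _↦_ (i : ℤ) (x : ℚ) : Set where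
  constructor embeds
  field embed : fromℤ i ≡ x

fromℤ-↦ : ∀ i → i ↦ fromℤ i
fromℤ-↦ i = embeds refl

_✚_ : ∀ {i j x y} → i ↦ x → j ↦ y → i ℤ.+ j ↦ x ℚ.+ y
_✚_ {i} {j} (embeds e) (embeds f) = embeds (trans (fromℤ-homo-+ i j) (cong₂ ℚ._+_ e f))

_✶_ : ∀ {i j x y} → i ↦ x → j ↦ y → i ℤ.* j ↦ x ℚ.* y
_✶_ {i} {j} (embeds e) (embeds f) = embeds (trans (fromℤ-homo-* i j) (cong₂ ℚ._*_ e f))

-‿↦ : ∀ {i x} → i ↦ x → ℤ.- i ↦ ℚ.- x
-‿↦ {i} (embeds e) = embeds (trans (fromℤ-homo‿- i) (cong ℚ.-_ e))

-- q⁴ quartic A B (p / q) = p⁴ + q * cofactor A B p q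
cofactor : ℤ → ℤ → ℤ → ℤ → ℤ
cofactor A B p q = + 18 ℤ.* A ℤ.* (p ℤ.* p ℤ.* q) ℤ.+ + 108 ℤ.* B ℤ.* (p ℤ.* q ℤ.* q)
  ℤ.+ ℤ.- (+ 27 ℤ.* (A ℤ.* A) ℤ.* (q ℤ.* q ℤ.* q))

homogenise : ∀ A B t p q → t ℚ.* fromℤ q ≡ fromℤ p → quarticℚ (fromℤ A) (fromℤ B) t ≡ 0ℚ →
  p ℤ.* p ℤ.* p ℤ.* p ℤ.+ q ℤ.* cofactor A B p q ≡ 0ℤ
homogenise A B t p q tq≡p root = fromℤ-injective (begin
  fromℤ (p ℤ.* p ℤ.* p ℤ.* p ℤ.+ q ℤ.* cofactor A B p q)    ≡⟨ _↦_.embed homogeneous ⟩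
  form (fromℤ A) (fromℤ B) t (fromℤ q)                      ≡⟨ factor (fromℤ A) (fromℤ B) t (fromℤ q) ⟩
  quarticℚ (fromℤ A) (fromℤ B) t ℚ.* q⁴                     ≡⟨ cong (ℚ._* q⁴) root ⟩
  0ℚ ℚ.* q⁴                                                 ≡⟨ ℚ.*-zeroˡ q⁴ ⟩
  0ℚ                                                        ∎)
  where
  open ≡-Reasoning
  open ℚ-Solver

  q⁴ : ℚ
  q⁴ = fromℤ q ℚ.* fromℤ q ℚ.* fromℤ q ℚ.* fromℤ q

  form : ℚ → ℚ → ℚ → ℚ → ℚ
  form a b t q = s ℚ.* s ℚ.* s ℚ.* s ℚ.+ q ℚ.* (fromℤ (+ 18) ℚ.* a ℚ.* (s ℚ.* s ℚ.* q)
    ℚ.+ fromℤ (+ 108) ℚ.* b ℚ.* (s ℚ.* q ℚ.* q) ℚ.+ ℚ.- (fromℤ (+ 27) ℚ.* (a ℚ.* a) ℚ.* (q ℚ.* q ℚ.* q)))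
    where s = t ℚ.* q

  -- Sending p to t * q instead of `fromℤ p` turns the homogeneous form into a polynomial in t and q
  -- from which q⁴ factors out.
  P : p ↦ t ℚ.* fromℤ q
  P = embeds (sym tq≡p)

  Q : q ↦ fromℤ q
  Q = fromℤ-↦ q

  homogeneous = P ✶ P ✶ P ✶ P ✚ Q ✶ (fromℤ-↦ (+ 18) ✶ fromℤ-↦ A ✶ (P ✶ P ✶ Q)
    ✚ fromℤ-↦ (+ 108) ✶ fromℤ-↦ B ✶ (P ✶ Q ✶ Q) ✚ -‿↦ (fromℤ-↦ (+ 27) ✶ (fromℤ-↦ A ✶ fromℤ-↦ A) ✶ (Q ✶ Q ✶ Q)))

  factor : ∀ a b t q → form a b t q ≡ quarticℚ a b t ℚ.* (q ℚ.* q ℚ.* q ℚ.* q)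
  factor = solve 4 (λ a b t q → let s = t :* q in
    s :* s :* s :* s :+ q :* (:fromℕ 18 :* a :* (s :* s :* q)
      :+ :fromℕ 108 :* b :* (s :* q :* q) :+ :- (:fromℕ 27 :* (a :* a) :* (q :* q :* q))) :=
    :quarticℚ a b t :* (q :* q :* q :* q)) refl

dehomogenise : ∀ A B p {q} → q ≡ 1 →
  p ℤ.* p ℤ.* p ℤ.* p ℤ.+ + q ℤ.* cofactor A B p (+ q) ≡ 0ℤ → quartic A B p ≡ 0ℤ
dehomogenise A B p refl = trans (identity A B p)
  where
  open ℤ-Solver
  identity : ∀ A B p → quartic A B p ≡ p ℤ.* p ℤ.* p ℤ.* p ℤ.+ + 1 ℤ.* cofactor A B p (+ 1)
  identity = solve 3 (λ A B p → let one = con (+ 1) in :quartic A B p :=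
    p :* p :* p :* p :+ one :* (con (+ 18) :* A :* (p :* p :* one) :+ con (+ 108) :* B :* (p :* one :* one)
      :+ :- (con (+ 27) :* (A :* A) :* (one :* one :* one)))) refl

-- The rational root argument: q divides p⁴, and coprimality strips the factors p one at a time
-- until q divides p itself.
monic⇒denominator≡1 : ∀ p {q} r → Coprime ∣ p ∣ q → p ℤ.* p ℤ.* p ℤ.* p ℤ.+ + q ℤ.* r ≡ 0ℤ → q ≡ 1
monic⇒denominator≡1 p {q} r coprime eq =
  coprime (cancel p (cancel (p ℤ.* p) (cancel (p ℤ.* p ℤ.* p) q∣p⁴)) , ∣-refl)
  where
  open ℤ-Solver

  cancel : ∀ i → q ∣ ∣ i ℤ.* p ∣ → q ∣ ∣ i ∣
  cancel i q∣ip = coprime-divisor (Coprimality.sym coprime)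
    (subst (q ∣_) (trans (ℤ.abs-* i p) (*-comm ∣ i ∣ ∣ p ∣)) q∣ip)

  isolate : ∀ x y z → x ≡ x ℤ.+ y ℤ.* z ℤ.+ ℤ.- z ℤ.* y
  isolate = solve 3 (λ x y z → x := x :+ y :* z :+ :- z :* y) refl

  q∣p⁴ : q ∣ ∣ p ℤ.* p ℤ.* p ℤ.* p ∣
  q∣p⁴ = ℤ.∣⇒∣ᵤ (ℤ.divides (ℤ.- r) (trans (isolate (p ℤ.* p ℤ.* p ℤ.* p) (+ q) r)
    (trans (cong (λ z → z ℤ.+ ℤ.- r ℤ.* + q) eq) (ℤ.+-identityˡ (ℤ.- r ℤ.* + q)))))

rational-root⇒integer-root : ∀ A B t → quarticℚ (fromℤ A) (fromℤ B) t ≡ 0ℚ → quartic A B (↥ t) ≡ 0ℤ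
rational-root⇒integer-root A B t@(mkℚ p d c) root = dehomogenise A B p
  (monic⇒denominator≡1 p (cofactor A B p (+ suc d)) (Coprimality.recompute c) homogenised) homogenised
  where
  homogenised : p ℤ.* p ℤ.* p ℤ.* p ℤ.+ + suc d ℤ.* cofactor A B p (+ suc d) ≡ 0ℤ
  homogenised = homogenise A B t p (+ suc d) (*-denominator t) root

-- Existence of a positive integer root

nonNegative-root⇒ℕ-root : ∀ A B t → .{{ℚ.NonNegative t}} → quarticℚ (fromℤ A) (fromℤ B) t ≡ 0ℚ →
  ∃[ u ] quartic A B (+ u) ≡ 0ℤ
nonNegative-root⇒ℕ-root A B t@(mkℚ (+ p) _ _) root = p , rational-root⇒integer-root A B t root

p*p-nonNegative : ∀ p → ℚ.NonNegative (p ℚ.* p)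
p*p-nonNegative p with ℚ.≤-total 0ℚ p
... | inj₁ 0≤p = ℚ.nonNeg*nonNeg⇒nonNeg p {{ℚ.nonNegative 0≤p}} p {{ℚ.nonNegative 0≤p}}
... | inj₂ p≤0 = ℚ.nonPos*nonPos⇒nonPos p {{ℚ.nonPositive p≤0}} p {{ℚ.nonPositive p≤0}}

3-torsion⇒root : ∀ A B x y → E[ 3 ]⟨ A , B ⟩ (affine x y) → ∃[ u ] quartic A B (+ u) ≡ 0ℤ
3-torsion⇒root A B x y (Curve.affine curve , 3P≡0E)
  with m , slope , flex ← 3-torsion⇒slope (fromℤ A) (fromℤ B) x y 3P≡0E
  = nonNegative-root⇒ℕ-root A B (m ℚ.* m) {{p*p-nonNegative m}}
      (slope²-root (fromℤ A) (fromℤ B) x y m curve slope flex)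

-- The constant term is -27A², and every other term is a multiple of t.
root∣27A² : ∀ A B u → quartic A B (+ u) ≡ 0ℤ → u ∣ ∣ + 27 ℤ.* (A ℤ.* A) ∣
root∣27A² A B u root = ℤ.∣⇒∣ᵤ (ℤ.divides (quotient (+ u)) (trans (isolate A B (+ u))
  (trans (cong (λ r → quotient (+ u) ℤ.* + u ℤ.- r) root) (ℤ.+-identityʳ (quotient (+ u) ℤ.* + u)))))
  where
  open ℤ-Solver

  quotient : ℤ → ℤ
  quotient t = t ℤ.* t ℤ.* t ℤ.+ + 18 ℤ.* A ℤ.* t ℤ.+ + 108 ℤ.* B

  isolate : ∀ A B t → + 27 ℤ.* (A ℤ.* A) ≡
    (t ℤ.* t ℤ.* t ℤ.+ + 18 ℤ.* A ℤ.* t ℤ.+ + 108 ℤ.* B) ℤ.* t ℤ.- quartic A B t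
  isolate = solve 3 (λ A B t → con (+ 27) :* (A :* A) :=
    (t :* t :* t :+ con (+ 18) :* A :* t :+ con (+ 108) :* B) :* t :- :quartic A B t) refl

-- As a root divides 27A², it is found by a bounded search; this recovers a root from
-- the mere negation of E[3] ≐ {0E}.
positive-root : ∀ A B → .{{ℤ.NonZero A}} → ¬ (E[ 3 ]⟨ A , B ⟩ ≐ ｛ 0E ｝) →
  ∃[ u ] (NonZero u × quartic A B (+ u) ≡ 0ℤ)
positive-root A B nontrivial
  with anyUpTo? (λ u → quartic A B (+ u) ℤ.≟ 0ℤ) (suc ∣ + 27 ℤ.* (A ℤ.* A) ∣)
     | ℤ.i*j≢0 (+ 27) (A ℤ.* A) {{_}} {{ℤ.i*j≢0 A A}}
... | yes (u , _ , root) | 27A²≢0 = u , ≢-nonZero u≢0 , root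
  where
  -- A zero root would divide 27A², forcing A = 0.
  u≢0 : u ≢ 0
  u≢0 refl = ≢-nonZero⁻¹ _ {{27A²≢0}} (0∣⇒≡0 (root∣27A² A B 0 root))
... | no noRoot | 27A²≢0 = contradiction ((λ {P} → trivial P) , λ { refl → Curve.0E , refl }) nontrivial
  where
  trivial : ∀ P → E[ 3 ]⟨ A , B ⟩ P → 0E ≡ P
  trivial 0E           _ = refl
  trivial (affine x y) t with 3-torsion⇒root A B x y t
  ... | u , root = contradiction (u , s≤s (∣⇒≤ {{27A²≢0}} (root∣27A² A B u root)) , root) noRoot

-- Roots belonging to the same A

-- With v = u + d, weighting the two quartics by v and u gives B and B′ the common coefficient
-- 108uv, and the terms in A complete a square. The last summand vanishes at roots; keeping it makes
-- this a polynomial identity for the solver.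
gap : ∀ A B B′ u d →
  u ℤ.* (u ℤ.+ d) ℤ.* (+ 108 ℤ.* (B ℤ.- B′)) ≡
  u ℤ.* (u ℤ.+ d) ℤ.* (d ℤ.* d ℤ.* d)
    ℤ.+ + 3 ℤ.* d ℤ.* ((+ 3 ℤ.* A ℤ.+ u ℤ.* (u ℤ.+ d)) ℤ.* (+ 3 ℤ.* A ℤ.+ u ℤ.* (u ℤ.+ d)))
    ℤ.+ ((u ℤ.+ d) ℤ.* quartic A B u ℤ.- u ℤ.* quartic A B′ (u ℤ.+ d))
gap = solve 5 (λ A B B′ u d → let v = u :+ d; w = con (+ 3) :* A :+ u :* v in
  u :* v :* (con (+ 108) :* (B :- B′)) :=
  u :* v :* (d :* d :* d) :+ con (+ 3) :* d :* (w :* w)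
    :+ (v :* :quartic A B u :- u :* :quartic A B′ v)) refl
  where open ℤ-Solver

0≤i*j : ∀ {i j} → 0ℤ ℤ.≤ i → 0ℤ ℤ.≤ j → 0ℤ ℤ.≤ i ℤ.* j
0≤i*j {+ m} {+ n} _ _ = subst (0ℤ ℤ.≤_) (ℤ.pos-* m n) (ℤ.+≤+ z≤n)

0≤i*i : ∀ i → 0ℤ ℤ.≤ i ℤ.* i
0≤i*i i@(+ _)  = 0≤i*j {i} {i} (ℤ.+≤+ z≤n) (ℤ.+≤+ z≤n)
0≤i*i -[1+ _ ] = ℤ.+≤+ z≤n

i≤+∣i∣ : ∀ i → i ℤ.≤ + ∣ i ∣
i≤+∣i∣ (+ _)    = ℤ.≤-refl
i≤+∣i∣ -[1+ _ ] = ℤ.-≤+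

root-gap : ∀ A B B′ u d → .{{NonZero u}} → quartic A B (+ u) ≡ 0ℤ → quartic A B′ (+ (u + d)) ≡ 0ℤ →
  d * d * d ≤ 108 * ∣ B ℤ.- B′ ∣
root-gap A B B′ u@(suc _) d root root′ = ℤ.drop‿+≤+ (begin
  + (d * d * d)              ≡⟨ trans (ℤ.pos-* (d * d) d) (cong (ℤ._* + d) (ℤ.pos-* d d)) ⟩
  d³                         ≤⟨ ℤ.*-cancelˡ-≤-pos d³ (+ 108 ℤ.* (B ℤ.- B′)) (+ u ℤ.* v) scaled ⟩
  + 108 ℤ.* (B ℤ.- B′)       ≤⟨ ℤ.*-monoˡ-≤-nonNeg (+ 108) (i≤+∣i∣ (B ℤ.- B′)) ⟩
  + 108 ℤ.* + ∣ B ℤ.- B′ ∣   ≡⟨ ℤ.pos-* 108 ∣ B ℤ.- B′ ∣ ⟨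
  + (108 * ∣ B ℤ.- B′ ∣)     ∎)
  where
  open ℤ.≤-Reasoning
  v w d³ square : ℤ
  v = + u ℤ.+ + d
  w = + 3 ℤ.* A ℤ.+ + u ℤ.* v
  d³ = + d ℤ.* + d ℤ.* + d
  square = + 3 ℤ.* + d ℤ.* (w ℤ.* w)

  vanish : v ℤ.* quartic A B (+ u) ℤ.- + u ℤ.* quartic A B′ v ≡ 0ℤ
  vanish = cong₂ ℤ._-_ (trans (cong (v ℤ.*_) root) (ℤ.*-zeroʳ v))
                       (trans (cong (+ u ℤ.*_) root′) (ℤ.*-zeroʳ (+ u)))

  0≤square : 0ℤ ℤ.≤ square
  0≤square = 0≤i*j (0≤i*j {+ 3} {+ d} (ℤ.+≤+ z≤n) (ℤ.+≤+ z≤n)) (0≤i*i w)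

  scaled : + u ℤ.* v ℤ.* d³ ℤ.≤ + u ℤ.* v ℤ.* (+ 108 ℤ.* (B ℤ.- B′))
  scaled = begin
    + u ℤ.* v ℤ.* d³                      ≤⟨ ℤ.i≤i+j _ square {{ℤ.nonNegative 0≤square}} ⟩
    + u ℤ.* v ℤ.* d³ ℤ.+ square           ≡⟨ ℤ.+-identityʳ _ ⟨
    + u ℤ.* v ℤ.* d³ ℤ.+ square ℤ.+ 0ℤ    ≡⟨ cong (λ z → + u ℤ.* v ℤ.* d³ ℤ.+ square ℤ.+ z) vanish ⟨
    + u ℤ.* v ℤ.* d³ ℤ.+ square ℤ.+ (v ℤ.* quartic A B (+ u) ℤ.- + u ℤ.* quartic A B′ v)
                                          ≡⟨ gap A B B′ (+ u) (+ d) ⟨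
    + u ℤ.* v ℤ.* (+ 108 ℤ.* (B ℤ.- B′))  ∎

-- The quartic is linear in B, with coefficient 108u.
root-determines-B : ∀ A B B′ u → .{{NonZero u}} →
  quartic A B (+ u) ≡ 0ℤ → quartic A B′ (+ u) ≡ 0ℤ → B ≡ B′
root-determines-B A B B′ u@(suc _) root root′ =
  ℤ.*-cancelˡ-≡ (+ 108 ℤ.* + u) B B′ {{ℤ.i*j≢0 (+ 108) (+ u)}}
    (ℤ.i-j≡0⇒i≡j (+ 108 ℤ.* + u ℤ.* B) (+ 108 ℤ.* + u ℤ.* B′)
      (trans (identity A B B′ (+ u)) (cong₂ ℤ._-_ root root′)))
  where
  open ℤ-Solver
  identity : ∀ A B B′ t → + 108 ℤ.* t ℤ.* B ℤ.- + 108 ℤ.* t ℤ.* B′ ≡ quartic A B t ℤ.- quartic A B′ t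
  identity = solve 4 (λ A B B′ t → con (+ 108) :* t :* B :- con (+ 108) :* t :* B′ :=
    :quartic A B t :- :quartic A B′ t) refl

-- Equal residues make d a multiple of k, and no positive multiple is below k.
+-%-injective : ∀ u d k .{{_ : NonZero k}} → (u + d) % k ≡ u % k → d < k → d ≡ 0
+-%-injective u zero      k eq d<k = refl
+-%-injective u d@(suc _) k eq d<k = contradiction (∣⇒≤ k∣d) (<⇒≱ d<k)
  where
  open ≡-Reasoning
  k∣d : k ∣ d
  k∣d = divides ((u + d) / k ∸ u / k) (begin
    d                            ≡⟨ m+n∸m≡n u d ⟨
    u + d ∸ u                    ≡⟨ cong₂ _∸_ (m≡m%n+[m/n]*n (u + d) k) (m≡m%n+[m/n]*n u k) ⟩
    ((u + d) % k + (u + d) / k * k) ∸ (u % k + u / k * k)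
                                 ≡⟨ cong (λ r → (r + (u + d) / k * k) ∸ (u % k + u / k * k)) eq ⟩
    (u % k + (u + d) / k * k) ∸ (u % k + u / k * k)
                                 ≡⟨ [m+n]∸[m+o]≡n∸o (u % k) _ _ ⟩
    (u + d) / k * k ∸ u / k * k  ≡⟨ *-distribʳ-∸ k ((u + d) / k) (u / k) ⟨
    ((u + d) / k ∸ u / k) * k    ∎)

module _ {k N : ℕ} .{{_ : NonZero k}} (108N<k² : 108 * N < k * k) where

  -- `root-gap` keeps the roots less than k apart, so congruent roots coincide and then determine B.
  ordered-congruent-roots⇒B-equal : ∀ A B B′ u v → .{{NonZero u}} →
    quartic A B (+ u) ≡ 0ℤ → quartic A B′ (+ v) ≡ 0ℤ → ∣ B ℤ.- B′ ∣ ≤ N → u % k ≡ v % k → u ≤ v → B ≡ B′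
  ordered-congruent-roots⇒B-equal A B B′ u v root root′ ∣B-B′∣≤N u≡v u≤v
    with d , refl ← m≤n⇒∃[o]m+o≡n u≤v
    = root-determines-B A B B′ u root (subst (λ t → quartic A B′ (+ t) ≡ 0ℤ) u+d≡u root′)
    where
    d<k : d < k
    d<k = ≰⇒> λ k≤d → <⇒≱ 108N<k² (begin
      -- Here the cube-root bound on d is relaxed to a square-root one, enough for the final
      -- estimate.
      k * k                 ≤⟨ m≤m*n (k * k) k ⟩
      k * k * k             ≤⟨ *-mono-≤ (*-mono-≤ k≤d k≤d) k≤d ⟩
      d * d * d             ≤⟨ root-gap A B B′ u d root root′ ⟩
      108 * ∣ B ℤ.- B′ ∣    ≤⟨ *-monoʳ-≤ 108 ∣B-B′∣≤N ⟩
      108 * N               ∎)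
      where open ≤-Reasoning

    u+d≡u : u + d ≡ u
    u+d≡u = trans (cong (λ r → u + r) (+-%-injective u d k (sym u≡v) d<k)) (+-identityʳ u)

  congruent-roots⇒B-equal : ∀ A B B′ u v → .{{NonZero u}} → .{{NonZero v}} →
    quartic A B (+ u) ≡ 0ℤ → quartic A B′ (+ v) ≡ 0ℤ → ∣ B ℤ.- B′ ∣ ≤ N → u % k ≡ v % k → B ≡ B′
  congruent-roots⇒B-equal A B B′ u v root root′ ∣B-B′∣≤N u≡v with ≤-total u v
  ... | inj₁ u≤v = ordered-congruent-roots⇒B-equal A B B′ u v root root′ ∣B-B′∣≤N u≡v u≤v
  ... | inj₂ v≤u = sym (ordered-congruent-roots⇒B-equal A B′ B v u root′ root
    (subst (_≤ N) (ℤ.∣i-j∣≡∣j-i∣ B B′) ∣B-B′∣≤N) (sym u≡v) v≤u)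

-- Counting

lookup-injective : ∀ {X : Set} {xs : List X} → Unique xs → ∀ {i j} → lookup xs i ≡ lookup xs j → i ≡ j
lookup-injective {xs = _ ∷ xs} (x∉xs ∷ u) {zero}  {zero}  eq = refl
lookup-injective {xs = _ ∷ xs} (x∉xs ∷ u) {zero}  {suc j} eq = contradiction eq (All.lookup x∉xs (∈-lookup j))
lookup-injective {xs = _ ∷ xs} (x∉xs ∷ u) {suc i} {zero}  eq = contradiction (sym eq) (All.lookup x∉xs (∈-lookup i))
lookup-injective {xs = _ ∷ xs} (x∉xs ∷ u) {suc i} {suc j} eq = cong suc (lookup-injective u eq)

-- The code may depend on the proof of `P x`, so injectivity is asked across arbitrary proofs. It
-- then embeds the positions of a duplicate-free list into `Fin n`.
injective-code⇒length≤ : ∀ {X : Set} {P : Pred X 0ℓ} {n} (code : ∀ {x} → P x → Fin n) →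
  (∀ {x y} (p : P x) (q : P y) → code p ≡ code q → x ≡ y) →
  ∀ {xs} → Unique xs → All P xs → length xs ≤ n
injective-code⇒length≤ code code-injective {xs} unique all =
  injective⇒≤ {f = λ i → code (All.lookup all (∈-lookup i))} λ eq → lookup-injective unique (code-injective _ _ eq)

-- An integer substitute for √n. The induction keeps k until the argument reaches k², then passes to
-- k + 1, where k + 1 ≤ 2k preserves the upper bound.
square-between : ∀ n → .{{NonZero n}} → ∃[ k ] (n < k * k × k * k ≤ 4 * n)
square-between 1 = 2 , s≤s (s≤s z≤n) , ≤-refl
square-between (suc n@(suc _)) with square-between n
... | k , n<k² , k²≤4n with m≤n⇒m<n∨m≡n n<k²
... | inj₁ 1+n<k² = k , 1+n<k² , ≤-trans k²≤4n (*-monoʳ-≤ 4 (n≤1+n n))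
... | inj₂ eq = suc k , subst (_< suc k * suc k) (sym eq) (*-mono-< (n<1+n k) (n<1+n k)) , (begin
  suc k * suc k     ≤⟨ *-mono-≤ 1+k≤2k 1+k≤2k ⟩
  2 * k * (2 * k)   ≡⟨ ring k ⟩
  4 * (k * k)       ≡⟨ cong (4 *_) eq ⟨
  4 * suc n         ∎)
  where
  open ≤-Reasoning

  ring : ∀ k → 2 * k * (2 * k) ≡ 4 * (k * k)
  ring = solve-∀

  0<k : ∀ k → suc n ≡ k * k → 0 < k
  0<k (suc k) _ = s≤s z≤n

  1+k≤2k : suc k ≤ 2 * k
  1+k≤2k = subst (suc k ≤_) (cong (λ r → k + r) (sym (+-identityʳ k))) (+-monoˡ-≤ k (0<k k eq))

-- Equal signs reduce the difference to that of the absolute values, which share an interval of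
-- length N.
same-sign⇒∣i-j∣≤ : ∀ {M N} i j → sign i ≡ sign j → M ≤ ∣ i ∣ → ∣ i ∣ ≤ M + N → M ≤ ∣ j ∣ → ∣ j ∣ ≤ M + N →
  ∣ i ℤ.- j ∣ ≤ N
same-sign⇒∣i-j∣≤ {M} {N} i j s≡ M≤i i≤ M≤j j≤ =
  subst (_≤ N) (sym (∣-∣-same i j s≡)) (bound (∣ i ∣) (∣ j ∣) M≤i i≤ M≤j j≤)
  where
  bound : ∀ m n → M ≤ m → m ≤ M + N → M ≤ n → n ≤ M + N → ∣ m ℤ.⊖ n ∣ ≤ N
  bound m n M≤m m≤ M≤n n≤ with ≤-total m n
  ... | inj₁ m≤n = subst (_≤ N) (sym (ℤ.∣⊖∣-≤ m≤n)) (≤-trans (∸-mono n≤ M≤m) (≤-reflexive (m+n∸m≡n M N)))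
  ... | inj₂ n≤m = subst (_≤ N) (trans (sym (ℤ.∣⊖∣-≤ n≤m)) (ℤ.∣m⊖n∣≡∣n⊖m∣ n m))
                     (≤-trans (∸-mono m≤ M≤n) (≤-reflexive (m+n∸m≡n M N)))

  ∣-∣-same : ∀ i j → sign i ≡ sign j → ∣ i ℤ.- j ∣ ≡ ∣ ∣ i ∣ ℤ.⊖ ∣ j ∣ ∣
  ∣-∣-same (+ m)    (+ n)    _ = cong ∣_∣ (ℤ.m-n≡m⊖n m n)
  ∣-∣-same -[1+ m ] -[1+ n ] _ = ℤ.∣m⊖n∣≡∣n⊖m∣ (suc n) (suc m)

fromSign : Sign → Fin 2
fromSign Sign.- = zero
fromSign Sign.+ = suc zero

fromSign-injective : ∀ {s t} → fromSign s ≡ fromSign t → s ≡ t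
fromSign-injective {Sign.-} {Sign.-} _ = refl
fromSign-injective {Sign.+} {Sign.+} _ = refl

-- Encoding the pairs in S

module _ {M₁ N₁ M₂ N₂ k : ℕ} (0<M₁ : 0 < M₁) .{{_ : NonZero k}} (108N₂<k² : 108 * N₂ < k * k) where

  S-root : ∀ {AB} → S M₁ N₁ M₂ N₂ AB → ∃[ u ] (NonZero u × quartic (proj₁ AB) (proj₂ AB) (+ u) ≡ 0ℤ)
  S-root {A , B} s = positive-root A B {{>-nonZero (<-≤-trans 0<M₁ (S.A-lower s))}} (S.3-torsion s)

  A-offset : ∀ {AB} (s : S M₁ N₁ M₂ N₂ AB) → Fin (suc N₁)
  A-offset {A , B} s = fromℕ< {∣ A ∣ ∸ M₁} (s≤s (m≤n+o⇒m∸n≤o ∣ A ∣ M₁ (S.A-upper s)))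

  -- The sign of A recovers A from its absolute value; the sign of B secures |B - B′| ≤ N₂ for pairs
  -- with equal codes.
  code : ∀ {AB} → S M₁ N₁ M₂ N₂ AB → Fin ((2 * 2) * (suc N₁ * k))
  code {A , B} s = combine (combine (fromSign (sign A)) (fromSign (sign B)))
    (combine (A-offset s) (fromℕ< (m%n<n (proj₁ (S-root s)) k)))

  code-injective : ∀ {AB AB′} (s : S M₁ N₁ M₂ N₂ AB) (s′ : S M₁ N₁ M₂ N₂ AB′) → code s ≡ code s′ → AB ≡ AB′
  code-injective {A , B} {A′ , B′} s s′ eq
    with signs , rest ← combine-injective _ _ _ _ eq
    with signA , signB ← combine-injective _ _ _ _ signs
    with offset , residue ← combine-injective _ _ _ _ rest
    -- Sign and offset identify A with A′, so both roots belong to the same A.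
    with refl ← ℤ.◃-cong {A} {A′} (fromSign-injective signA)
      (∸-cancelʳ-≡ (S.A-lower s) (S.A-lower s′) (fromℕ<-injective _ _ _ _ offset))
    = cong (A ,_) (congruent-roots⇒B-equal 108N₂<k² A B B′ u v {{u≢0}} {{v≢0}} root root′
        (same-sign⇒∣i-j∣≤ B B′ (fromSign-injective signB) (S.B-lower s) (S.B-upper s) (S.B-lower s′) (S.B-upper s′))
        (fromℕ<-injective _ _ _ _ residue))
    where
    u v : ℕ
    u = proj₁ (S-root s)
    v = proj₁ (S-root s′)
    u≢0 = proj₁ (proj₂ (S-root s))
    v≢0 = proj₁ (proj₂ (S-root s′))
    root = proj₂ (proj₂ (S-root s))
    root′ = proj₂ (proj₂ (S-root s′))

-- One factor N₂ comes from bounding the minimum, the other from k².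
code-count-bound : ∀ {l N₁ N₂ k} → 0 < N₁ → k * k ≤ 4 * (108 * N₂) → l ≤ (2 * 2) * (suc N₁ * k) →
  l ^ 2 * (N₁ ⊓ N₂) ≤ (167 * (N₁ * N₂)) ^ 2
code-count-bound {l} {N₁} {N₂} {k} 0<N₁ k²≤ l≤ = begin
  l ^ 2 * (N₁ ⊓ N₂)                       ≤⟨ *-mono-≤ (^-monoˡ-≤ 2 l≤8N₁k) (m⊓n≤n N₁ N₂) ⟩
  (8 * (N₁ * k)) ^ 2 * N₂                 ≡⟨ regroup N₁ N₂ k ⟩
  64 * (N₁ * N₁) * N₂ * (k * k)           ≤⟨ *-monoʳ-≤ (64 * (N₁ * N₁) * N₂) k²≤ ⟩
  64 * (N₁ * N₁) * N₂ * (4 * (108 * N₂))  ≡⟨ collect N₁ N₂ ⟩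
  -- 27648 = 64 · 4 · 108, and 27889 = 167² is the next square, whence the constant 167.
  27648 * (N₁ * N₂ * (N₁ * N₂))           ≤⟨ *-monoˡ-≤ (N₁ * N₂ * (N₁ * N₂)) (≤ᵇ⇒≤ 27648 27889 _) ⟩
  27889 * (N₁ * N₂ * (N₁ * N₂))           ≡⟨ square (N₁ * N₂) ⟩
  (167 * (N₁ * N₂)) ^ 2                   ∎
  where
  open ≤-Reasoning

  double : ∀ n k → (2 * 2) * ((n + n) * k) ≡ 8 * (n * k)
  double = solve-∀

  -- The factor 1 comes from unfolding `^ 2`.
  regroup : ∀ m n k → 8 * (m * k) * (8 * (m * k) * 1) * n ≡ 64 * (m * m) * n * (k * k)
  regroup = solve-∀

  collect : ∀ m n → 64 * (m * m) * n * (4 * (108 * n)) ≡ 27648 * (m * n * (m * n))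
  collect = solve-∀

  square : ∀ n → 27889 * (n * n) ≡ 167 * n * (167 * n * 1)
  square = solve-∀

  -- Since N₁ ≥ 1, the count N₁ + 1 of absolute values is at most 2N₁.
  l≤8N₁k : l ≤ 8 * (N₁ * k)
  l≤8N₁k = ≤-trans l≤ (≤-trans (*-monoʳ-≤ (2 * 2) (*-monoˡ-≤ k (+-monoˡ-≤ N₁ 0<N₁))) (≤-reflexive (double N₁ k)))

proposition7p1 : ∃[ C ] (0 < C × (∀ (M₁ N₁ M₂ N₂ : ℕ) → 0 < M₁ → 0 < N₁ → 0 < M₂ → 0 < N₂ →
    # S M₁ N₁ M₂ N₂ ≤ C * (N₁ * N₂) /√ (N₁ ⊓ N₂)))
proposition7p1 = 167 , s≤s z≤n , bound
  where
  bound : ∀ (M₁ N₁ M₂ N₂ : ℕ) → 0 < M₁ → 0 < N₁ → 0 < M₂ → 0 < N₂ →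
    # S M₁ N₁ M₂ N₂ ≤ 167 * (N₁ * N₂) /√ (N₁ ⊓ N₂)
  bound M₁ N₁ M₂ N₂@(suc _) 0<M₁ 0<N₁ _ _ xs unique all
    -- The modulus k has size about √N₂, balancing the requirement k² > 108N₂ against the k residues
    -- counted.
    with square-between (108 * N₂)
  ... | zero        , () , _
  ... | k@(suc _) , N<k² , k²≤ =
    code-count-bound {N₂ = N₂} {k} 0<N₁ k²≤ (injective-code⇒length≤ (code 0<M₁ N<k²) (code-injective 0<M₁ N<k²) unique all)
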